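{- Let $r\ge 1$, let $\tau$ be a bijection from $F^r$ to $F^r$ with $\tau({\bf 0})={\bf 0}$, and let $l$ be the distension of $\tau$. Then the rank of the code $S_{\mathcal H,\tau}=\bigcup_{a\in F^r}\mathcal H_a\times\mathcal H_{\tau(a)}$ is $(2^{r+1}-r-2)+l$.
   Context: $F=\mathrm{GF}(2)$; a code of length $n$ is a set of vectors of $F^n$. $\mathrm{wt}$ is Hamming weight. ${\bf 0}$ denotes the all-zero vector. The rank of a code $C$ is the dimension of its linear span over $F$. The coordinates of $F^{2^r}$ are indexed by the vectors of $F^r$; $e_a$ is the vector whose only nonzero coordinate is the one indexed by $a$. $\mathcal H=\{c\in F^{2^r}:\sum_{a:c_a=1}a={\bf 0},\ \mathrm{wt}(c)\equiv 0 \pmod 2\}$, and $\mathcal H_a=\mathcal H+e_a+e_{\bf 0}$ for $a\in F^r$. For codes $C,D$, $C\times D=\{x|y: x\in C,\ y\in D\}$, where $x|y$ is concatenation. A bijection $\tau:F^r\to F^r$ is regarded as a permutation of the coordinate positions of $F^{2^r}$, acting on $x\in F^{2^r}$ by $\tau(x)_b=x_{\tau^{ -1}(b)}$; $\tau(\mathcal H)=\{\tau(x):x\in\mathcal H\}$. The distension of $\tau$ (with $\tau({\bf 0})={\bf 0}$) is $2^r-r-1-\dim(\mathcal H\cap\tau(\mathcal H))$, where $2^r-r-1=\dim(\mathcal H)$. -}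

module Defs where

open import Algebra.Properties.CommutativeMonoid.Sum using (sum)
open import Data.Fin using (Fin)
open import Data.List using (List; []; _∷_; cartesianProductWith; filter; foldr; length)
open import Data.Nat using (ℕ; zero; suc; _^_; _∸_)
open import Data.Nat.Divisibility using (_∣_)
open import Data.Parity using (Parity; 0ℙ; 1ℙ; _+_; _*_; _≟_)
open import Data.Parity.Properties using (+-0-commutativeMonoid)
open import Data.Product using (Σ-syntax; ∃-syntax; _×_)
open import Data.Sum using (_⊎_; [_,_])
open import Data.Vec using (Vec; []; _∷_; replicate; zipWith)
open import Data.Vec.Properties using (≡-dec)
open import Function using (_↔_; Inverse)
open import Level using (0ℓ)
open import Relation.Binary.PropositionalEquality using (_≡_; _≗_)
open import Relation.Nullary using (yes; no)
open import Relation.Unary using (Pred; _∈_; _∩_; _≐_; ⋃)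

-- GF(2) is the library's ring of parities.
F : Set
F = Parity

-- The vector space F^I of words with coordinates indexed by I. Equality of
-- words is pointwise equality _≗_, as function extensionality is unavailable.
Word : Set → Set
Word I = I → F

Code : Set → Set₁
Code I = Pred (Word I) 0ℓ

infixl 6 _⊹_

_⊹_ : ∀ {I} → Word I → Word I → Word I
(x ⊹ y) i = x i + y i

linComb : ∀ {I k} → (Fin k → F) → (Fin k → Word I) → Word I
linComb c v i = sum +-0-commutativeMonoid (λ j → c j * v j i)

SpanOf : ∀ {I k} → (Fin k → Word I) → Code I
SpanOf v w = ∃[ c ] w ≗ linComb c v

LinearlyIndependent : ∀ {I k} → (Fin k → Word I) → Set
LinearlyIndependent v =
  ∀ c → linComb c v ≗ (λ _ → 0ℙ) → ∀ j → c j ≡ 0ℙ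

IsBasis : ∀ {I k} → Code I → (Fin k → Word I) → Set
IsBasis V b = LinearlyIndependent b × V ≐ SpanOf b

HasDimension : ∀ {I} → Code I → ℕ → Set
HasDimension {I} V k = Σ[ b ∈ (Fin k → Word I) ] IsBasis V b

-- The linear span of an arbitrary set of words.
Span : ∀ {I} → Code I → Code I
Span {I} C w =
  ∃[ k ] Σ[ v ∈ (Fin k → Word I) ] (∀ j → v j ∈ C) × w ∈ SpanOf v

HasRank : ∀ {I} → Code I → ℕ → Set
HasRank C k = HasDimension (Span C) k

_+ᶜ_ : ∀ {I} → Code I → Word I → Code I
(C +ᶜ v) w = ∃[ x ] x ∈ C × w ≗ x ⊹ v

-- Concatenation x|y is [ x , y ], with coordinates in the disjoint union.
_×ᶜ_ : ∀ {I J} → Code I → Code J → Code (I ⊎ J)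
(C ×ᶜ D) w = ∃[ x ] ∃[ y ] x ∈ C × y ∈ D × w ≗ [ x , y ]

allVecs : ∀ r → List (Vec F r)
allVecs zero    = [] ∷ []
allVecs (suc r) = cartesianProductWith _∷_ (0ℙ ∷ 1ℙ ∷ []) (allVecs r)

𝟎 : ∀ {r} → Vec F r
𝟎 {r} = replicate r 0ℙ

support : ∀ {r} → Word (Vec F r) → List (Vec F r)
support {r} c = filter (λ a → c a ≟ 1ℙ) (allVecs r)

wt : ∀ {r} → Word (Vec F r) → ℕ
wt c = length (support c)

e : ∀ {r} → Vec F r → Word (Vec F r)
e a b with ≡-dec _≟_ a b
... | yes _ = 1ℙ
... | no  _ = 0ℙ

ℋ : ∀ r → Code (Vec F r)
ℋ r c = foldr (zipWith _+_) 𝟎 (support c) ≡ 𝟎 × 2 ∣ wt c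

ℋ[_] : ∀ {r} → Vec F r → Code (Vec F r)
ℋ[_] {r} a = ℋ r +ᶜ (e a ⊹ e 𝟎)

permute : ∀ {I} → I ↔ I → Word I → Word I
permute τ x b = x (Inverse.from τ b)

image : ∀ {I} → I ↔ I → Code I → Code I
image τ C w = ∃[ x ] x ∈ C × w ≗ permute τ x

-- The subtractions never truncate: 2 ^ r ∸ r ∸ 1 is the dimension of ℋ r,
-- which contains the intersection.
IsDistension : ∀ {r} → Vec F r ↔ Vec F r → ℕ → Set
IsDistension {r} τ l =
  ∃[ d ] HasDimension (ℋ r ∩ image τ (ℋ r)) d × l ≡ 2 ^ r ∸ r ∸ 1 ∸ d

S : ∀ {r} → Vec F r ↔ Vec F r → Code (Vec F r ⊎ Vec F r)
S {r} τ = ⋃ (Vec F r) λ a → ℋ[ a ] ×ᶜ ℋ[ Inverse.to τ a ]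

{-# OPTIONS --safe #-}

-- Since τ(e_a + e_0) = e_τ(a) + e_0, and these words represent
-- the cosets of ℋ in the even-weight code, the span of S is
-- { (x | τ(x) + y) : x even, y ∈ ℋ + τ(ℋ) }. Its dimension is
-- (2^r − 1) + 2 dim ℋ − dim (ℋ ∩ τ(ℋ)) = (2^r − 1) + dim ℋ + l.
-- The dimension of ℋ comes from recursion on r: (z + u | z) lies in ℋ for r + 1
-- iff z is even and u lies in ℋ for r.
module Submission where

open import Defs
open import Data.Fin using (Fin; zero; suc)
open import Data.List using (List; []; _∷_; _++_; map; filter; foldr; length)
open import Data.List.Membership.Propositional using () renaming (_∈_ to _∈ˡ_)
open import Data.List.Membership.Propositional.Properties
  using (∈-cartesianProductWith⁺)
open import Data.List.Properties
  using (++-identityʳ; filter-++; length-++; length-map)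
open import Data.List.Relation.Unary.Any using (here; there)
open import Data.Nat using (ℕ; zero; suc; parity; _≤_; _^_; _+_; _∸_)
open import Data.Nat.Divisibility using (_∣_; divides; ∣m∣n⇒∣m+n; ∣-refl)
open import Data.Nat.Properties
  using (+-assoc; +-comm; +-identityʳ; +-suc; m+n∸m≡n; m+n∸n≡m; ∸-+-assoc)
open import Data.Nat.Solver using (module +-*-Solver)
open import Data.Parity as ℙ using (0ℙ; 1ℙ; _≟_)
import Data.Parity.Properties as ℙ
open import Data.Product using (∃-syntax; _×_; _,_; proj₁; proj₂)
open import Data.Sum using (_⊎_; inj₁; inj₂; [_,_])
open import Data.Unit using (tt)
open import Data.Vec using (Vec; []; _∷_; zipWith)
import Data.Vec.Functional as Vector
open import Data.Vec.Properties
  using (≡-dec; ∷-injective; zipWith-assoc; zipWith-identityˡ)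
open import Function using (_↔_; Inverse; _∘_; id)
open import Relation.Binary.PropositionalEquality
  using (_≡_; _≢_; _≗_; refl; sym; trans; cong; cong₂; subst; module ≡-Reasoning)
open import Relation.Nullary using (¬_; Dec; yes; no; contradiction; _×-dec_; _→-dec_)
open import Relation.Nullary.Decidable using (from-yes; map′)
open import Relation.Unary using (U; _∩_; _≐_; _⊆_)
open import Relation.Unary.Properties using (≐-refl; ≐-sym; ≐-trans)

open import Algebra.Properties.CommutativeSemigroup ℙ.+-commutativeSemigroup
  using () renaming (interchange to +-interchange; xy∙z≈xz∙y to +-swapʳ)

-- Identities of GF(2), checked on all values

∀? : ∀ {P : F → Set} → (∀ p → Dec (P p)) → Dec (∀ p → P p)
∀? P? = map′ (λ { (p₀ , p₁) → λ { 0ℙ → p₀ ; 1ℙ → p₁ } })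
             (λ p → p 0ℙ , p 1ℙ) (P? 0ℙ ×-dec P? 1ℙ)

+-cancel : ∀ x y → x ℙ.+ y ℙ.+ y ≡ x
+-cancel = from-yes (∀? λ x → ∀? λ y → x ℙ.+ y ℙ.+ y ≟ x)

+-conj : ∀ x y → x ℙ.+ y ℙ.+ x ≡ y
+-conj = from-yes (∀? λ x → ∀? λ y → x ℙ.+ y ℙ.+ x ≟ y)

+-zero⇒≡ : ∀ x y → x ℙ.+ y ≡ 0ℙ → x ≡ y
+-zero⇒≡ = from-yes (∀? λ x → ∀? λ y → (x ℙ.+ y ≟ 0ℙ) →-dec (x ≟ y))

+-translate : ∀ x y z → (x ℙ.+ z) ℙ.+ (y ℙ.+ z) ≡ x ℙ.+ y
+-translate = from-yes (∀? λ x → ∀? λ y → ∀? λ z → (x ℙ.+ z) ℙ.+ (y ℙ.+ z) ≟ x ℙ.+ y)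

+-transpose : ∀ {x z} y → x ℙ.+ y ≡ z → x ≡ z ℙ.+ y
+-transpose {x} y eq = trans (sym (+-cancel x y)) (cong (ℙ._+ y) eq)

-- Subspaces, linear maps and dimension

𝟘 : ∀ {I} → Word I
𝟘 _ = 0ℙ

-- Over GF(2), closure under scalars is contained in `𝟘∈`. The field `resp` is there because a code
-- is an arbitrary predicate, while words are compared only pointwise.
record Subspace {I} (V : Code I) : Set where
  field
    resp     : ∀ {x y} → x ≗ y → V x → V y
    𝟘∈       : V 𝟘
    ⊹-closed : ∀ {x y} → V x → V y → V (x ⊹ y)

open Subspace

record Linear {I J} (f : Word I → Word J) : Set where
  field
    respects : ∀ {x y} → x ≗ y → f x ≗ f y
    homo     : ∀ x y → f (x ⊹ y) ≗ f x ⊹ f y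

  𝟘-homo : f 𝟘 ≗ 𝟘
  𝟘-homo i = trans (homo 𝟘 𝟘 i) (ℙ.p+p≡0ℙ (f 𝟘 i))

open Linear

id-linear : ∀ {I} → Linear {I} id
id-linear = record { respects = id ; homo = λ _ _ _ → refl }

-- As -v = v, membership of w in the coset D + v can be tested on w + v, without an existential
-- witness.
adjoin : ∀ {I} → Code I → Word I → Code I
adjoin D v w = D w ⊎ D (w ⊹ v)

-- Over GF(2) a subspace of dimension suc k is D ∪ (D + v) for a subspace D of
-- dimension k and some v outside D.
data Dim {I} (V : Code I) : ℕ → Set₁ where
  trivial : V ≐ (_≗ 𝟘) → Dim V 0
  extend  : ∀ {D v k} → Dim D k → ¬ D v → V ≐ adjoin D v → Dim V (suc k)

Dim-resp : ∀ {I k} {V W : Code I} → V ≐ W → Dim V k → Dim W k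
Dim-resp V≐W (trivial z)      = trivial (≐-trans (≐-sym V≐W) z)
Dim-resp V≐W (extend dD v∉ e) = extend dD v∉ (≐-trans (≐-sym V≐W) e)

subspace-resp : ∀ {I} {V W : Code I} → V ≐ W → Subspace W → Subspace V
subspace-resp (to , from) S = record
  { resp     = λ e → from ∘ resp S e ∘ to
  ; 𝟘∈       = from (𝟘∈ S)
  ; ⊹-closed = λ x y → from (⊹-closed S (to x) (to y))
  }

zero-subspace : ∀ {I} → Subspace {I} (_≗ 𝟘)
zero-subspace = record
  { resp     = λ e z i → trans (sym (e i)) (z i)
  ; 𝟘∈       = λ _ → refl
  ; ⊹-closed = λ x y i → cong₂ ℙ._+_ (x i) (y i)
  }

adjoin-subspace : ∀ {I} {D : Code I} v → Subspace D → Subspace (adjoin D v)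
adjoin-subspace {D = D} v S = record
  { resp     = λ { e (inj₁ x) → inj₁ (resp S e x)
                 ; e (inj₂ x) → inj₂ (resp S (λ i → cong (ℙ._+ v i) (e i)) x) }
  ; 𝟘∈       = inj₁ (𝟘∈ S)
  ; ⊹-closed = λ {x} {y} → closed x y
  }
  where
  closed : ∀ x y → adjoin D v x → adjoin D v y → adjoin D v (x ⊹ y)
  closed x y (inj₁ a) (inj₁ b) = inj₁ (⊹-closed S a b)
  closed x y (inj₁ a) (inj₂ b) =
    inj₂ (resp S (λ i → sym (ℙ.+-assoc (x i) (y i) (v i))) (⊹-closed S a b))
  closed x y (inj₂ a) (inj₁ b) =
    inj₂ (resp S (λ i → +-swapʳ (x i) (v i) (y i)) (⊹-closed S a b))
  closed x y (inj₂ a) (inj₂ b) =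
    inj₁ (resp S (λ i → +-translate (x i) (y i) (v i)) (⊹-closed S a b))

Dim⇒Subspace : ∀ {I k} {V : Code I} → Dim V k → Subspace V
Dim⇒Subspace (trivial z)          = subspace-resp z zero-subspace
Dim⇒Subspace (extend {v = v} dD _ e) =
  subspace-resp e (adjoin-subspace v (Dim⇒Subspace dD))

-- Puts x + v into the second branch of `adjoin D v`.
⊹-cancel : ∀ {I} {D : Code I} → Subspace D → ∀ x v → D x → D (x ⊹ v ⊹ v)
⊹-cancel S x v = resp S (λ i → sym (+-cancel (x i) (v i)))

-- Bases

-- The adjoined vectors form a basis: in a vanishing combination the newest vector v has coefficient
-- 0, since otherwise v would be a combination of the earlier ones and lie in D.
Dim⇒HasDimension : ∀ {I k} {V : Code I} → Dim V k → HasDimension V k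
Dim⇒HasDimension (trivial z) =
  (λ ()) , (λ _ _ ()) , (λ Vw → (λ ()) , proj₁ z Vw) , (λ { (_ , e) → proj₂ z e })
Dim⇒HasDimension {I} {suc k} {V} (extend {D} {v} dD v∉D V≐)
  with Dim⇒HasDimension dD
... | b , independent , D⊆ , D⊇ = b′ , independent′ , V⊆ , V⊇
  where
  b′ : Fin (suc k) → Word I
  b′ = v Vector.∷ b

  head-zero : ∀ c → linComb c b′ ≗ 𝟘 → c zero ≡ 0ℙ
  head-zero c e with c zero
  ... | 0ℙ = refl
  ... | 1ℙ = contradiction (D⊇ (c ∘ suc , λ i → +-zero⇒≡ (v i) _ (e i))) v∉D

  independent′ : LinearlyIndependent b′
  independent′ c e zero    = head-zero c e
  independent′ c e (suc j) = independent (c ∘ suc)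
    -- With the head coefficient replaced by 0, the head term disappears by computation and a
    -- relation among `b` remains.
    (λ i → trans (cong (λ α → α ℙ.* v i ℙ.+ linComb (c ∘ suc) b i)
                       (sym (head-zero c e)))
                 (e i)) j

  V⊆ : V ⊆ SpanOf b′
  V⊆ {w} Vw with proj₁ V≐ Vw
  ... | inj₁ d = let c , e = D⊆ d in 0ℙ Vector.∷ c , e
  ... | inj₂ d = let c , e = D⊆ d in 1ℙ Vector.∷ c ,
    λ i → trans (+-transpose (v i) (e i)) (ℙ.+-comm _ (v i))

  V⊇ : SpanOf b′ ⊆ V
  V⊇ {w} (c , e) with c zero
  ... | 0ℙ = proj₂ V≐ (inj₁ (D⊇ (c ∘ suc , e)))
  ... | 1ℙ = proj₂ V≐ (inj₂ (D⊇ (c ∘ suc ,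
    λ i → trans (cong (ℙ._+ v i) (e i)) (+-conj (v i) _))))

-- The first vector is outside the span of the others: adding it to an expression of it by the
-- others would give a vanishing combination with leading coefficient 1.
span-Dim : ∀ {I k} (b : Fin k → Word I) → LinearlyIndependent b → Dim (SpanOf b) k
span-Dim {k = zero}  b _ = trivial (proj₂ , λ e → (λ ()) , e)
span-Dim {k = suc k} b independent =
  extend (span-Dim (b ∘ suc) (λ c e j → independent (0ℙ Vector.∷ c) e (suc j)))
    b₀∉ (⊆′ , ⊇′)
  where
  b₀∉ : ¬ SpanOf (b ∘ suc) (b zero)
  b₀∉ (c , e) with () ← independent (1ℙ Vector.∷ c)
    (λ i → trans (cong (ℙ._+ linComb c (b ∘ suc) i) (e i)) (ℙ.p+p≡0ℙ (linComb c (b ∘ suc) i))) zero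

  ⊆′ : SpanOf b ⊆ adjoin (SpanOf (b ∘ suc)) (b zero)
  ⊆′ (c , e) with c zero
  ... | 0ℙ = inj₁ (c ∘ suc , e)
  ... | 1ℙ = inj₂ (c ∘ suc ,
    λ i → trans (cong (ℙ._+ b zero i) (e i)) (+-conj (b zero i) _))

  ⊇′ : adjoin (SpanOf (b ∘ suc)) (b zero) ⊆ SpanOf b
  ⊇′ (inj₁ (c , e)) = 0ℙ Vector.∷ c , e
  ⊇′ (inj₂ (c , e)) = 1ℙ Vector.∷ c ,
    λ i → trans (+-transpose (b zero i) (e i)) (ℙ.+-comm _ (b zero i))

HasDimension⇒Dim : ∀ {I k} {V : Code I} → HasDimension V k → Dim V k
HasDimension⇒Dim (b , independent , V≐) = Dim-resp (≐-sym V≐) (span-Dim b independent)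

-- Sums and complements

-- The maps f and g let one notion cover V + W inside one space (both `id`), words assembled from
-- two blocks, and images of a single code.
Sum : ∀ {I J K} → (Word I → Word K) → (Word J → Word K) → Code I → Code J → Code K
Sum f g C D w = ∃[ x ] ∃[ y ] C x × D y × w ≗ f x ⊹ g y

Sum-swap : ∀ {I J K} (f : Word I → Word K) (g : Word J → Word K) {C D} →
           Sum f g C D ⊆ Sum g f D C
Sum-swap f g (x , y , Cx , Dy , e) =
  y , x , Dy , Cx , λ i → trans (e i) (ℙ.+-comm (f x i) (g y i))

-- In characteristic 2, f x = g y means f x + g y = 0. For linear maps and subspaces this is
-- therefore injectivity of (x, y) ↦ f x + g y on C × D.
Direct : ∀ {I J K} → (Word I → Word K) → (Word J → Word K) → Code I → Code J → Set
Direct f g C D = ∀ {x y} → C x → D y → f x ≗ g y → x ≗ 𝟘 × y ≗ 𝟘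

Direct-swap : ∀ {I J K} {f : Word I → Word K} {g : Word J → Word K} {C D} →
              Direct f g C D → Direct g f D C
Direct-swap direct Dy Cx e =
  let x≗𝟘 , y≗𝟘 = direct Cx Dy (λ i → sym (e i)) in y≗𝟘 , x≗𝟘

-- Adjoining v to C′ adjoins f v to the sum. If f v = f x + g y with x in C′, then f (x + v) = g y,
-- and directness gives x = v, contrary to v being outside C′.
extend-Sum : ∀ {I J K k} {f : Word I → Word K} {g : Word J → Word K} {C C′ D v} →
             Linear f → Subspace C′ → ¬ C′ v → C ≐ adjoin C′ v →
             Direct f g C D → Dim (Sum f g C′ D) k → Dim (Sum f g C D) (suc k)
extend-Sum {f = f} {g} {C} {C′} {D} {v} lf S v∉ (to , from) direct dim =
  extend dim fv∉ (⊆′ , ⊇′)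
  where
  fv∉ : ¬ Sum f g C′ D (f v)
  fv∉ (x , y , C′x , Dy , e) = v∉ (resp S (λ i → +-zero⇒≡ (x i) (v i) (x⊹v≗𝟘 i)) C′x)
    where
    x⊹v≗𝟘 = proj₁ (direct (from (inj₂ (⊹-cancel S x v C′x))) Dy λ i →
      trans (homo lf x v i)
        (trans (cong (f x i ℙ.+_) (e i))
          (trans (sym (ℙ.+-assoc (f x i) (f x i) (g y i)))
                 (cong (ℙ._+ g y i) (ℙ.p+p≡0ℙ (f x i))))))

  ⊆′ : Sum f g C D ⊆ adjoin (Sum f g C′ D) (f v)
  ⊆′ (x , y , Cx , Dy , e) with to Cx
  ... | inj₁ C′x  = inj₁ (x , y , C′x , Dy , e)
  ... | inj₂ C′xv = inj₂ (x ⊹ v , y , C′xv , Dy , λ i →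
    trans (cong (ℙ._+ f v i) (e i))
      (trans (+-swapʳ (f x i) (g y i) (f v i))
             (cong (ℙ._+ g y i) (sym (homo lf x v i)))))

  ⊇′ : adjoin (Sum f g C′ D) (f v) ⊆ Sum f g C D
  ⊇′ (inj₁ (x , y , C′x , Dy , e)) = x , y , from (inj₁ C′x) , Dy , e
  ⊇′ (inj₂ (x , y , C′x , Dy , e)) =
    x ⊹ v , y , from (inj₂ (⊹-cancel S x v C′x)) , Dy , λ i →
    trans (+-transpose (f v i) (e i))
      (trans (+-swapʳ (f x i) (g y i) (f v i))
             (cong (ℙ._+ g y i) (sym (homo lf x v i))))

-- Each extension step of C or D contributes one dimension. `extend-Sum` enlarges the first summand
-- only, so steps of D are made after swapping the summands.
Sum-Dim : ∀ {I J K k m} {f : Word I → Word K} {g : Word J → Word K} {C D} →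
          Linear f → Linear g → Direct f g C D →
          Dim C k → Dim D m → Dim (Sum f g C D) (k + m)
Sum-Dim lf lg direct (trivial (C⊆ , C⊇)) (trivial (D⊆ , D⊇)) = trivial
  ( (λ { (x , y , Cx , Dy , e) i → trans (e i)
         (cong₂ ℙ._+_ (trans (respects lf (C⊆ Cx) i) (𝟘-homo lf i))
                      (trans (respects lg (D⊆ Dy) i) (𝟘-homo lg i))) })
  , (λ z → 𝟘 , 𝟘 , C⊇ (λ _ → refl) , D⊇ (λ _ → refl) , λ i → trans (z i)
         (sym (cong₂ ℙ._+_ (𝟘-homo lf i) (𝟘-homo lg i)))) )
Sum-Dim {f = f} {g} lf lg direct dC@(trivial _) (extend dD v∉ D≐) =
  Dim-resp (Sum-swap g f , Sum-swap f g)
    (extend-Sum lg (Dim⇒Subspace dD) v∉ D≐ (Direct-swap {f = f} {g} direct)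
      (Dim-resp (Sum-swap f g , Sum-swap g f)
        (Sum-Dim lf lg (λ Cx Dy → direct Cx (proj₂ D≐ (inj₁ Dy))) dC dD)))
Sum-Dim lf lg direct (extend dC v∉ C≐) dD =
  extend-Sum lf (Dim⇒Subspace dC) v∉ C≐ direct
    (Sum-Dim lf lg (λ Cx → direct (proj₂ C≐ (inj₁ Cx))) dC dD)

-- Steinitz exchange: any nonzero δ in D can be the last vector of a basis of D.
exchange : ∀ {I k} {D : Code I} {δ} → Dim D k → D δ → ¬ δ ≗ 𝟘 →
           ∃[ k′ ] ∃[ D′ ] k ≡ suc k′ × Dim D′ k′ × ¬ D′ δ × D ≐ adjoin D′ δ
exchange (trivial (z , _)) Dδ δ≢𝟘 = contradiction (z Dδ) δ≢𝟘
exchange {D = D} {δ} (extend {D₀} {v} dD₀ v∉D₀ (to , from)) Dδ δ≢𝟘 with to Dδ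
-- Here δ lies in D₀: exchange inside D₀, then adjoin v again to the smaller space.
... | inj₁ D₀δ
  with k₁ , D₁ , refl , dD₁ , δ∉D₁ , to₁ , from₁ ← exchange dD₀ D₀δ δ≢𝟘 =
  suc k₁ , adjoin D₁ v , refl
  , extend dD₁ (λ D₁v → v∉D₀ (from₁ (inj₁ D₁v))) ≐-refl
  , δ∉ , ⊆′ , ⊇′
  where
  S₀ = Dim⇒Subspace dD₀
  S₁ = Dim⇒Subspace dD₁

  δ∉ : ¬ adjoin D₁ v δ
  δ∉ (inj₁ D₁δ)  = δ∉D₁ D₁δ
  δ∉ (inj₂ D₁δv) = v∉D₀ (resp S₀ (λ i → +-conj (δ i) (v i))
    (⊹-closed S₀ (from₁ (inj₁ D₁δv)) D₀δ))

  ⊆′ : D ⊆ adjoin (adjoin D₁ v) δ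
  ⊆′ {w} Dw with to Dw
  ... | inj₁ D₀w with to₁ D₀w
  ...   | inj₁ D₁w  = inj₁ (inj₁ D₁w)
  ...   | inj₂ D₁wδ = inj₂ (inj₁ D₁wδ)
  ⊆′ {w} Dw | inj₂ D₀wv with to₁ D₀wv
  ...   | inj₁ D₁wv  = inj₁ (inj₂ D₁wv)
  ...   | inj₂ D₁wvδ = inj₂ (inj₂ (resp S₁ (λ i → +-swapʳ (w i) (v i) (δ i)) D₁wvδ))

  ⊇′ : adjoin (adjoin D₁ v) δ ⊆ D
  ⊇′ (inj₁ (inj₁ D₁w))       = from (inj₁ (from₁ (inj₁ D₁w)))
  ⊇′ (inj₁ (inj₂ D₁wv))      = from (inj₂ (from₁ (inj₁ D₁wv)))
  ⊇′ (inj₂ (inj₁ D₁wδ))      = from (inj₁ (from₁ (inj₂ D₁wδ)))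
  ⊇′ {w} (inj₂ (inj₂ D₁wδv)) = from (inj₂ (from₁ (inj₂
    (resp S₁ (λ i → +-swapʳ (w i) (δ i) (v i)) D₁wδv))))
-- Here δ lies in D₀ + v, so δ replaces v over the same D₀.
... | inj₂ D₀δv = _ , D₀ , refl , dD₀ , δ∉ , ⊆′ , ⊇′
  where
  S₀ = Dim⇒Subspace dD₀

  δ∉ : ¬ D₀ δ
  δ∉ D₀δ = v∉D₀ (resp S₀ (λ i → +-conj (δ i) (v i)) (⊹-closed S₀ D₀δv D₀δ))

  ⊆′ : D ⊆ adjoin D₀ δ
  ⊆′ {w} Dw with to Dw
  ... | inj₁ D₀w  = inj₁ D₀w
  ... | inj₂ D₀wv = inj₂ (resp S₀ (λ i → +-translate (w i) (δ i) (v i))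
                            (⊹-closed S₀ D₀wv D₀δv))

  ⊇′ : adjoin D₀ δ ⊆ D
  ⊇′ (inj₁ D₀w)      = from (inj₁ D₀w)
  ⊇′ {w} (inj₂ D₀wδ) = from (inj₂ (resp S₀
    (λ i → trans (sym (ℙ.+-assoc (w i ℙ.+ δ i) (δ i) (v i)))
                 (cong (ℙ._+ v i) (+-cancel (w i) (δ i))))
    (⊹-closed S₀ D₀wδ D₀δv)))

-- Induction on U. When v is added to U₀, split v = u + δ along U₀ and its complement D₀. As v is
-- outside U₀, δ is nonzero and can be exchanged into the last basis vector of D₀; dropping it
-- leaves a complement of U₀ with v adjoined.
complement : ∀ {I d m} {U W : Code I} → Dim U d → Dim W m → U ⊆ W →
             ∃[ k ] ∃[ D ] d + k ≡ m × Dim D k × Direct id id U D × W ≐ Sum id id U D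
complement {m = m} {W = W} (trivial (U⊆ , U⊇)) dW _ =
  m , W , refl , dW
  , (λ Ux _ x≗y → U⊆ Ux , λ i → trans (sym (x≗y i)) (U⊆ Ux i))
  , (λ {w} Ww → 𝟘 , w , U⊇ (λ _ → refl) , Ww , λ _ → refl)
  , (λ { (x , y , Ux , Wy , e) → resp (Dim⇒Subspace dW)
         (λ i → sym (trans (e i) (cong (ℙ._+ y i) (U⊆ Ux i)))) Wy })
complement {U = U} {W} (extend {U₀} {v} dU₀ v∉U₀ (to , from)) dW U⊆W
  with k₀ , D₀ , d+k₀≡m , dD₀ , direct , W⊆ , W⊇ ←
         complement dU₀ dW (λ U₀x → U⊆W (from (inj₁ U₀x)))
  -- The vector v lies in U, hence in W, because v + v = 0 lies in U₀.
  with u , δ , U₀u , D₀δ , v≗u⊹δ ←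
         W⊆ (U⊆W (from (inj₂ (resp (Dim⇒Subspace dU₀)
           (λ i → sym (ℙ.p+p≡0ℙ (v i))) (𝟘∈ (Dim⇒Subspace dU₀))))))
  with k , D , refl , dD , δ∉D , D₀⊆ , D₀⊇ ←
         exchange dD₀ D₀δ (λ δ≗𝟘 → v∉U₀ (resp (Dim⇒Subspace dU₀)
           (λ i → sym (trans (v≗u⊹δ i) (trans (cong (u i ℙ.+_) (δ≗𝟘 i)) (ℙ.+-identityʳ (u i)))))
           U₀u)) =
  k , D , trans (sym (+-suc _ k)) d+k₀≡m , dD , direct′ , ⊆′ , ⊇′
  where
  SU₀ = Dim⇒Subspace dU₀
  SD₀ = Dim⇒Subspace dD₀
  SD  = Dim⇒Subspace dD
  SW  = Dim⇒Subspace dW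

  v⊹u≗δ : v ⊹ u ≗ δ
  v⊹u≗δ i = trans (cong (ℙ._+ u i) (v≗u⊹δ i)) (+-conj (u i) (δ i))

  direct′ : Direct id id U D
  direct′ {x} {y} Ux Dy x≗y with to Ux
  ... | inj₁ U₀x  = direct U₀x (D₀⊇ (inj₁ Dy)) x≗y
  -- Since v + u = δ, the word x + v + u of U₀ equals y + δ of D₀. Directness over U₀ forces y = δ,
  -- but δ is outside D.
  ... | inj₂ U₀xv = contradiction
    (resp SD (λ i → +-zero⇒≡ (y i) (δ i) (y⊹δ≗𝟘 i)) Dy) δ∉D
    where
    y⊹δ≗𝟘 : y ⊹ δ ≗ 𝟘
    y⊹δ≗𝟘 = proj₂ (direct (⊹-closed SU₀ U₀xv U₀u)
      (D₀⊇ (inj₂ (⊹-cancel SD y δ Dy)))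
      (λ i → trans (ℙ.+-assoc (x i) (v i) (u i)) (cong₂ ℙ._+_ (x≗y i) (v⊹u≗δ i))))

  ⊆′ : W ⊆ Sum id id U D
  ⊆′ {w} Ww with W⊆ Ww
  ... | x , y , U₀x , D₀y , e with D₀⊆ D₀y
  ...   | inj₁ Dy  = x , y , from (inj₁ U₀x) , Dy , e
  -- Move δ from the D₀ part to the U part, where it is written as u + v.
  ...   | inj₂ Dyδ = x ⊹ u ⊹ v , y ⊹ δ
    , from (inj₂ (⊹-cancel SU₀ (x ⊹ u) v (⊹-closed SU₀ U₀x U₀u))) , Dyδ
    , λ i → trans (e i) (sym (trans
        (cong (λ t → x i ℙ.+ u i ℙ.+ t ℙ.+ (y i ℙ.+ δ i)) (v≗u⊹δ i))
        (regroup (x i) (u i) (y i) (δ i))))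
    where
    regroup : ∀ x u y δ → x ℙ.+ u ℙ.+ (u ℙ.+ δ) ℙ.+ (y ℙ.+ δ) ≡ x ℙ.+ y
    regroup = from-yes (∀? λ x → ∀? λ u → ∀? λ y → ∀? λ δ →
      x ℙ.+ u ℙ.+ (u ℙ.+ δ) ℙ.+ (y ℙ.+ δ) ≟ x ℙ.+ y)

  ⊇′ : Sum id id U D ⊆ W
  ⊇′ (x , y , Ux , Dy , e) = resp SW (λ i → sym (e i))
    (⊹-closed SW (U⊆W Ux)
      (W⊇ (𝟘 , y , 𝟘∈ SU₀ , D₀⊇ (inj₁ Dy) , λ _ → refl)))

-- A complement D of V ∩ W in W meets V only in 0, and V + W = V ⊕ D. Here k is dim W - dim (V ∩ W).
Sum-∩-Dim : ∀ {I d m n} {V W : Code I} → Dim V n → Dim W m → Dim (V ∩ W) d →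
        ∃[ k ] d + k ≡ m × Dim (Sum id id V W) (n + k)
Sum-∩-Dim {V = V} {W} dV dW dVW
  with k , D , d+k≡m , dD , direct , W⊆ , W⊇ ← complement dVW dW proj₂ =
  k , d+k≡m , Dim-resp (⊆′ , ⊇′) (Sum-Dim id-linear id-linear direct′ dV dD)
  where
  SV = Dim⇒Subspace dV
  SVW = Dim⇒Subspace dVW

  D⊆W : D ⊆ W
  D⊆W {y} Dy = W⊇ (𝟘 , y , 𝟘∈ SVW , Dy , λ _ → refl)

  direct′ : Direct id id V D
  direct′ Vx Dy x≗y = direct
    (Vx , resp (Dim⇒Subspace dW) (λ i → sym (x≗y i)) (D⊆W Dy)) Dy x≗y

  ⊆′ : Sum id id V D ⊆ Sum id id V W
  ⊆′ (x , y , Vx , Dy , e) = x , y , Vx , D⊆W Dy , e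

  ⊇′ : Sum id id V W ⊆ Sum id id V D
  ⊇′ (x , y , Vx , Wy , e) with W⊆ Wy
  ... | x′ , y′ , (Vx′ , _) , Dy′ , e′ =
    x ⊹ x′ , y′ , ⊹-closed SV Vx Vx′ , Dy′
    , λ i → trans (e i) (trans (cong (x i ℙ.+_) (e′ i)) (sym (ℙ.+-assoc (x i) (x′ i) (y′ i))))

-- The case of `Sum-Dim` whose second summand is the zero space.
image-Dim : ∀ {I J k} {f : Word I → Word J} {C} → Linear f →
            (∀ {x} → f x ≗ 𝟘 → x ≗ 𝟘) → Dim C k →
            Dim (λ w → ∃[ x ] C x × w ≗ f x) k
image-Dim {J = J} {k} {f} {C} lf injective dC =
  subst (Dim _) (+-identityʳ k)
    (Dim-resp (⊆′ , ⊇′)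
      (Sum-Dim lf id-linear
        (λ _ z fx≗y → injective (λ i → trans (fx≗y i) (z i)) , z) dC (trivial {J} ≐-refl)))
  where
  ⊆′ : Sum f id C (_≗ 𝟘) ⊆ (λ w → ∃[ x ] C x × w ≗ f x)
  ⊆′ (x , y , Cx , z , e) =
    x , Cx , λ i → trans (e i) (trans (cong (f x i ℙ.+_) (z i)) (ℙ.+-identityʳ (f x i)))

  ⊇′ : (λ w → ∃[ x ] C x × w ≗ f x) ⊆ Sum f id C (_≗ 𝟘)
  ⊇′ (x , Cx , e) =
    x , 𝟘 , Cx , (λ _ → refl) , λ i → trans (e i) (sym (ℙ.+-identityʳ (f x i)))

-- Spans

Span-⊇ : ∀ {I} {C : Code I} → C ⊆ Span C
Span-⊇ {x = w} Cw =
  1 , (λ _ → w) , (λ _ → Cw) , (λ _ → 1ℙ) , λ i → sym (ℙ.+-identityʳ (w i))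

Span-subspace : ∀ {I} {C : Code I} → Subspace (Span C)
Span-subspace {C = C} = record
  { resp     = resp′
  ; 𝟘∈       = 0 , (λ ()) , (λ ()) , (λ ()) , λ _ → refl
  ; ⊹-closed = λ { (k , v , Cv , c , e) Vy →
      resp′ (λ i → cong (ℙ._+ _) (sym (e i))) (closed k v Cv c Vy) }
  }
  where
  resp′ : ∀ {x y} → x ≗ y → Span C x → Span C y
  resp′ x≗y (k , v , Cv , c , e) = k , v , Cv , c , λ i → trans (sym (x≗y i)) (e i)

  cons : ∀ {x y} → C x → Span C y → Span C (x ⊹ y)
  cons {x} Cx (k , v , Cv , c , e) =
    suc k , x Vector.∷ v , (λ { zero → Cx ; (suc j) → Cv j }) , 1ℙ Vector.∷ c
    , λ i → cong (x i ℙ.+_) (e i)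

  -- The vectors of the first combination that have coefficient 1 are prepended one at a time to the
  -- second, which avoids indexing a concatenated family.
  closed : ∀ k v → (∀ j → C (v j)) → ∀ c {y} → Span C y → Span C (linComb {k = k} c v ⊹ y)
  closed zero    v Cv c Vy = Vy
  closed (suc k) v Cv c {y} Vy with c zero | closed k (v ∘ suc) (Cv ∘ suc) (c ∘ suc) Vy
  ... | 0ℙ | ih = ih
  ... | 1ℙ | ih = resp′ (λ i → sym (ℙ.+-assoc (v zero i) _ (y i))) (cons (Cv zero) ih)

Span-least : ∀ {I} {C V : Code I} → Subspace V → C ⊆ V → Span C ⊆ V
Span-least {C = C} {V} S C⊆V (k , v , Cv , c , e) =
  resp S (λ i → sym (e i)) (linComb∈ k v Cv c)
  where
  linComb∈ : ∀ k v → (∀ j → C (v j)) → ∀ c → V (linComb {k = k} c v)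
  linComb∈ zero    v Cv c = 𝟘∈ S
  linComb∈ (suc k) v Cv c with c zero | linComb∈ k (v ∘ suc) (Cv ∘ suc) (c ∘ suc)
  ... | 0ℙ | ih = ih
  ... | 1ℙ | ih = ⊹-closed S (C⊆V (Cv zero)) ih

-- Parity check and syndrome

lo hi : ∀ {r} → Word (Vec F (suc r)) → Word (Vec F r)
lo c a = c (0ℙ ∷ a)
hi c a = c (1ℙ ∷ a)

infixl 6 _⊕_

_⊕_ : ∀ {r} → Vec F r → Vec F r → Vec F r
_⊕_ = zipWith ℙ._+_

⊕-identityˡ : ∀ {r} (a : Vec F r) → 𝟎 ⊕ a ≡ a
⊕-identityˡ = zipWith-identityˡ ℙ.+-identityˡ

⊕-interchange : ∀ {r} (a b c d : Vec F r) → (a ⊕ b) ⊕ (c ⊕ d) ≡ (a ⊕ c) ⊕ (b ⊕ d)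
⊕-interchange []      []      []      []      = refl
⊕-interchange (a ∷ as) (b ∷ bs) (c ∷ cs) (d ∷ ds) =
  cong₂ _∷_ (+-interchange a b c d) (⊕-interchange as bs cs ds)

total : ∀ {r} → Word (Vec F r) → F
total {zero}  c = c []
total {suc r} c = total (lo c) ℙ.+ total (hi c)

-- This is the sum of the positions a with c a = 1. Such a position has leading entry 1 exactly in
-- the upper half, so the leading entry of the sum is the parity of that half; the remaining entries
-- add up over both halves.
syndrome : ∀ {r} → Word (Vec F r) → Vec F r
syndrome {zero}  c = []
syndrome {suc r} c = total (hi c) ∷ (syndrome (lo c) ⊕ syndrome (hi c))

total-cong : ∀ {r} {x y : Word (Vec F r)} → x ≗ y → total x ≡ total y
total-cong {zero}  e = e []
total-cong {suc r} e =
  cong₂ ℙ._+_ (total-cong (e ∘ (0ℙ ∷_))) (total-cong (e ∘ (1ℙ ∷_)))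

total-homo : ∀ {r} (x y : Word (Vec F r)) → total (x ⊹ y) ≡ total x ℙ.+ total y
total-homo {zero}  x y = refl
total-homo {suc r} x y =
  trans (cong₂ ℙ._+_ (total-homo (lo x) (lo y)) (total-homo (hi x) (hi y)))
        (+-interchange (total (lo x)) (total (lo y)) (total (hi x)) (total (hi y)))

total-𝟘 : ∀ {r} → total {r} 𝟘 ≡ 0ℙ
total-𝟘 {r} = trans (total-homo {r} 𝟘 𝟘) (ℙ.p+p≡0ℙ (total {r} 𝟘))

syndrome-cong : ∀ {r} {x y : Word (Vec F r)} → x ≗ y → syndrome x ≡ syndrome y
syndrome-cong {zero}  e = refl
syndrome-cong {suc r} e = cong₂ _∷_ (total-cong (e ∘ (1ℙ ∷_)))
  (cong₂ _⊕_ (syndrome-cong (e ∘ (0ℙ ∷_))) (syndrome-cong (e ∘ (1ℙ ∷_))))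

syndrome-homo : ∀ {r} (x y : Word (Vec F r)) → syndrome (x ⊹ y) ≡ syndrome x ⊕ syndrome y
syndrome-homo {zero}  x y = refl
syndrome-homo {suc r} x y = cong₂ _∷_ (total-homo (hi x) (hi y))
  (trans (cong₂ _⊕_ (syndrome-homo (lo x) (lo y)) (syndrome-homo (hi x) (hi y)))
         (⊕-interchange (syndrome (lo x)) (syndrome (lo y)) (syndrome (hi x)) (syndrome (hi y))))

e-≢ : ∀ {r} {a b : Vec F r} → a ≢ b → e a b ≡ 0ℙ
e-≢ {a = a} {b} a≢b with ≡-dec _≟_ a b
... | yes a≡b = contradiction a≡b a≢b
... | no  _   = refl

e-transport : ∀ {r s} {a : Vec F r} {b} {a′ : Vec F s} {b′} →
              (a ≡ b → a′ ≡ b′) → (a′ ≡ b′ → a ≡ b) → e a b ≡ e a′ b′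
e-transport {a = a} {b} {a′} {b′} to from with ≡-dec _≟_ a b | ≡-dec _≟_ a′ b′
... | yes _   | yes _   = refl
... | yes a≡b | no a≢b  = contradiction (to a≡b) a≢b
... | no a≢b  | yes a≡b = contradiction (from a≡b) a≢b
... | no _    | no _    = refl

e-same : ∀ {r} p (a : Vec F r) → e (p ∷ a) ∘ (p ∷_) ≗ e a
e-same p a b = e-transport (proj₂ ∘ ∷-injective) (cong (p ∷_))

e-other : ∀ {r} p q (a : Vec F r) → p ≢ q → e (p ∷ a) ∘ (q ∷_) ≗ 𝟘
e-other p q a p≢q b = e-≢ (p≢q ∘ proj₁ ∘ ∷-injective)

total-e : ∀ {r} (a : Vec F r) → total (e a) ≡ 1ℙ
total-e []               = refl
total-e {suc r} (0ℙ ∷ a) =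
  cong₂ ℙ._+_ (trans (total-cong (e-same 0ℙ a)) (total-e a))
              (trans (total-cong (e-other 0ℙ 1ℙ a λ ())) (total-𝟘 {r}))
total-e {suc r} (1ℙ ∷ a) =
  cong₂ ℙ._+_ (trans (total-cong (e-other 1ℙ 0ℙ a λ ())) (total-𝟘 {r}))
              (trans (total-cong (e-same 1ℙ a)) (total-e a))

-- Comparison with the definition of ℋ by supports

parity-even : ∀ {n} → 2 ∣ n → parity n ≡ 0ℙ
parity-even (divides q refl) = trans (ℙ.*-homo-* q 2) (ℙ.*-zeroʳ (parity q))

even-parity : ∀ n → parity n ≡ 0ℙ → 2 ∣ n
even-parity zero          _  = divides 0 refl
even-parity (suc (suc n)) eq = ∣m∣n⇒∣m+n ∣-refl (even-parity n eq)

vsum : ∀ {r} → List (Vec F r) → Vec F r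
vsum = foldr _⊕_ 𝟎

vsum-++ : ∀ {r} (xs ys : List (Vec F r)) → vsum (xs ++ ys) ≡ vsum xs ⊕ vsum ys
vsum-++ []       ys = sym (⊕-identityˡ (vsum ys))
vsum-++ (x ∷ xs) ys =
  trans (cong (x ⊕_) (vsum-++ xs ys))
        (sym (zipWith-assoc ℙ.+-assoc x (vsum xs) (vsum ys)))

vsum-0∷ : ∀ {r} (xs : List (Vec F r)) → vsum (map (0ℙ ∷_) xs) ≡ 0ℙ ∷ vsum xs
vsum-0∷ []       = refl
vsum-0∷ (x ∷ xs) = cong ((0ℙ ∷ x) ⊕_) (vsum-0∷ xs)

vsum-1∷ : ∀ {r} (xs : List (Vec F r)) →
          vsum (map (1ℙ ∷_) xs) ≡ parity (length xs) ∷ vsum xs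
vsum-1∷ []       = refl
vsum-1∷ (x ∷ xs) =
  trans (cong ((1ℙ ∷ x) ⊕_) (vsum-1∷ xs))
        (cong (_∷ vsum (x ∷ xs)) (sym (ℙ.+-homo-+ 1 (length xs))))

filter-map : ∀ {r} (c : Word (Vec F (suc r))) p xs →
             filter (λ a → c a ≟ 1ℙ) (map (p ∷_) xs) ≡
             map (p ∷_) (filter (λ a → c (p ∷ a) ≟ 1ℙ) xs)
filter-map c p []       = refl
filter-map c p (x ∷ xs) with c (p ∷ x) ≟ 1ℙ
... | yes _ = cong ((p ∷ x) ∷_) (filter-map c p xs)
... | no  _ = filter-map c p xs

support-suc : ∀ {r} (c : Word (Vec F (suc r))) →
              support c ≡ map (0ℙ ∷_) (support (lo c)) ++ map (1ℙ ∷_) (support (hi c))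
support-suc {r} c = begin
  -- `allVecs` unfolds to the two halves followed by an empty list.
  filter P? (map (0ℙ ∷_) A ++ map (1ℙ ∷_) A ++ [])
    ≡⟨ cong (λ B → filter P? (map (0ℙ ∷_) A ++ B)) (++-identityʳ (map (1ℙ ∷_) A)) ⟩
  filter P? (map (0ℙ ∷_) A ++ map (1ℙ ∷_) A)
    ≡⟨ filter-++ P? (map (0ℙ ∷_) A) (map (1ℙ ∷_) A) ⟩
  filter P? (map (0ℙ ∷_) A) ++ filter P? (map (1ℙ ∷_) A)
    ≡⟨ cong₂ _++_ (filter-map c 0ℙ A) (filter-map c 1ℙ A) ⟩
  map (0ℙ ∷_) (support (lo c)) ++ map (1ℙ ∷_) (support (hi c)) ∎
  where
  open ≡-Reasoning
  A  = allVecs r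
  P? = λ a → c a ≟ 1ℙ

parity-wt : ∀ {r} (c : Word (Vec F r)) → parity (wt c) ≡ total c
parity-wt {zero} c with c []
... | 0ℙ = refl
... | 1ℙ = refl
parity-wt {suc r} c = begin
  parity (wt c)                           ≡⟨ cong (parity ∘ length) (support-suc c) ⟩
  parity (length (map (0ℙ ∷_) X ++ map (1ℙ ∷_) Y))
    ≡⟨ cong parity (length-++ (map (0ℙ ∷_) X)) ⟩
  parity (length (map (0ℙ ∷_) X) + length (map (1ℙ ∷_) Y))
    ≡⟨ cong parity (cong₂ _+_ (length-map (0ℙ ∷_) X) (length-map (1ℙ ∷_) Y)) ⟩
  parity (wt (lo c) + wt (hi c))          ≡⟨ ℙ.+-homo-+ (wt (lo c)) (wt (hi c)) ⟩
  parity (wt (lo c)) ℙ.+ parity (wt (hi c))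
    ≡⟨ cong₂ ℙ._+_ (parity-wt (lo c)) (parity-wt (hi c)) ⟩
  total c ∎
  where
  open ≡-Reasoning
  X = support (lo c)
  Y = support (hi c)

vsum-support : ∀ {r} (c : Word (Vec F r)) → vsum (support c) ≡ syndrome c
vsum-support {zero} c with vsum (support c)
... | [] = refl
vsum-support {suc r} c = begin
  vsum (support c)                        ≡⟨ cong vsum (support-suc c) ⟩
  vsum (map (0ℙ ∷_) X ++ map (1ℙ ∷_) Y)   ≡⟨ vsum-++ (map (0ℙ ∷_) X) (map (1ℙ ∷_) Y) ⟩
  vsum (map (0ℙ ∷_) X) ⊕ vsum (map (1ℙ ∷_) Y)
    ≡⟨ cong₂ _⊕_ (vsum-0∷ X) (vsum-1∷ Y) ⟩
  parity (wt (hi c)) ∷ (vsum X ⊕ vsum Y)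
    ≡⟨ cong₂ _∷_ (parity-wt (hi c)) (cong₂ _⊕_ (vsum-support (lo c)) (vsum-support (hi c))) ⟩
  syndrome c ∎
  where
  open ≡-Reasoning
  X = support (lo c)
  Y = support (hi c)

Even : ∀ r → Code (Vec F r)
Even r c = total c ≡ 0ℙ

-- The code `ℋ` expressed by recursive functions, so that it splits along the two halves of a word.
Check : ∀ r → Code (Vec F r)
Check r c = syndrome c ≡ 𝟎 × total c ≡ 0ℙ

Check≐ℋ : ∀ {r} → Check r ≐ ℋ r
Check≐ℋ =
  (λ {c} (s , t) → trans (vsum-support c) s , even-parity (wt c) (trans (parity-wt c) t)) ,
  (λ {c} (s , t) → trans (sym (vsum-support c)) s , trans (sym (parity-wt c)) (parity-even t))

-- Dimensions

-- Splitting F^(2^(r+1)) as (z + u | z).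
doubling : ∀ {r k m} {C D : Code (Vec F r)} {V} → Dim C k → Dim D m →
           V ≐ (λ c → C (hi c) × D (lo c ⊹ hi c)) → Dim V (k + m)
doubling {r} {C = C} {D} {V} dC dD (to , from) =
  Dim-resp (⊆′ , ⊇′) (Sum-Dim repeat-linear pad-linear direct dC dD)
  where
  repeat pad : Word (Vec F r) → Word (Vec F (suc r))
  repeat z (_ ∷ a) = z a
  pad u (0ℙ ∷ a) = u a
  pad u (1ℙ ∷ a) = 0ℙ

  repeat-linear : Linear repeat
  repeat-linear = record
    { respects = λ { e (_ ∷ a) → e a } ; homo = λ { _ _ (_ ∷ _) → refl } }

  pad-linear : Linear pad
  pad-linear = record
    { respects = λ { e (0ℙ ∷ a) → e a ; e (1ℙ ∷ a) → refl }
    ; homo     = λ { _ _ (0ℙ ∷ _) → refl ; _ _ (1ℙ ∷ _) → refl } }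

  direct : Direct repeat pad C D
  direct _ _ e = e ∘ (1ℙ ∷_) , λ a → trans (sym (e (0ℙ ∷ a))) (e (1ℙ ∷ a))

  ⊆′ : Sum repeat pad C D ⊆ V
  ⊆′ (z , u , Cz , Du , e) = from
    ( resp (Dim⇒Subspace dC) (λ a → sym (trans (e (1ℙ ∷ a)) (ℙ.+-identityʳ (z a)))) Cz
    , resp (Dim⇒Subspace dD) (λ a → sym (trans (cong₂ ℙ._+_ (e (0ℙ ∷ a)) (e (1ℙ ∷ a)))
        (regroup (z a) (u a)))) Du )
    where
    regroup : ∀ z u → z ℙ.+ u ℙ.+ (z ℙ.+ 0ℙ) ≡ u
    regroup = from-yes (∀? λ z → ∀? λ u → z ℙ.+ u ℙ.+ (z ℙ.+ 0ℙ) ≟ u)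

  ⊇′ : V ⊆ Sum repeat pad C D
  ⊇′ {w} Vw = let Chi , Dlo = to Vw in hi w , lo w ⊹ hi w , Chi , Dlo , λ
    { (0ℙ ∷ a) → sym (trans (sym (ℙ.+-assoc (hi w a) (lo w a) (hi w a)))
                            (+-conj (hi w a) (lo w a)))
    ; (1ℙ ∷ a) → sym (ℙ.+-identityʳ (hi w a)) }

double : ∀ n → n + n ≡ n + (n + 0)
double n = cong (n +_) (sym (+-identityʳ n))

U-Dim : ∀ r → Dim {Vec F r} U (2 ^ r)
U-Dim zero = extend {v = λ _ → 1ℙ} (trivial ≐-refl) (λ z → contradiction (z []) λ ())
  ((λ {w} _ → split w) , _)
  where
  split : ∀ w → adjoin (_≗ 𝟘) (λ _ → 1ℙ) w
  split w with w [] in eq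
  ... | 0ℙ = inj₁ λ { [] → eq }
  ... | 1ℙ = inj₂ λ { [] → cong (ℙ._+ 1ℙ) eq }
U-Dim (suc r) = subst (Dim U) (double (2 ^ r)) (doubling (U-Dim r) (U-Dim r) _)

-- In (z + u | z) the total of z cancels, so z is free and u is even. The equation with `suc k`
-- avoids truncated subtraction.
Even-Dim : ∀ r → ∃[ k ] suc k ≡ 2 ^ r × Dim (Even r) k
Even-Dim zero = 0 , refl , trivial ((λ { eq [] → eq }) , λ z → z [])
Even-Dim (suc r) with k , suc-k≡ , dE ← Even-Dim r =
  2 ^ r + k
  , trans (sym (+-suc (2 ^ r) k)) (trans (cong (2 ^ r +_) suc-k≡) (double (2 ^ r)))
  , doubling (U-Dim r) dE
      ( (λ {c} t → tt , trans (total-homo (lo c) (hi c)) t)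
      , (λ {c} (_ , t) → trans (sym (total-homo (lo c) (hi c))) t) )

-- The syndrome of (z + u | z) has leading entry `total z`; its other entries, and the total of the
-- word, are those of u because z cancels.
Check-Dim : ∀ r → ∃[ m ] m + suc r ≡ 2 ^ r × Dim (Check r) m
Check-Dim zero =
  0 , refl , trivial ((λ { (_ , eq) [] → eq }) , λ z → refl , z [])
Check-Dim (suc r)
  with k , suc-k≡ , dE ← Even-Dim r | m , m+suc-r≡ , dC ← Check-Dim r =
  k + m , dims , doubling dE dC ((λ {c} → ⊆′ {c}) , (λ {c} → ⊇′ {c}))
  where
  open ≡-Reasoning
  dims : (k + m) + suc (suc r) ≡ 2 ^ r + (2 ^ r + 0)
  dims = begin
    (k + m) + suc (suc r) ≡⟨ +-suc (k + m) (suc r) ⟩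
    suc (k + m + suc r)   ≡⟨ cong suc (+-assoc k m (suc r)) ⟩
    suc k + (m + suc r)   ≡⟨ cong₂ _+_ suc-k≡ m+suc-r≡ ⟩
    2 ^ r + 2 ^ r         ≡⟨ double (2 ^ r) ⟩
    2 ^ r + (2 ^ r + 0)   ∎

  ⊆′ : Check (suc r) ⊆ (λ c → Even r (hi c) × Check r (lo c ⊹ hi c))
  ⊆′ {c} (s , t) = let s₀ , s₁ = ∷-injective s in
    s₀ , trans (syndrome-homo (lo c) (hi c)) s₁ , trans (total-homo (lo c) (hi c)) t

  ⊇′ : (λ c → Even r (hi c) × Check r (lo c ⊹ hi c)) ⊆ Check (suc r)
  ⊇′ {c} (s₀ , s₁ , t) =
    cong₂ _∷_ s₀ (trans (sym (syndrome-homo (lo c) (hi c))) s₁)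
    , trans (sym (total-homo (lo c) (hi c))) t

-- Generators of the full space and of the even-weight code

∈-allVecs : ∀ {r} (a : Vec F r) → a ∈ˡ allVecs r
∈-allVecs []      = here refl
∈-allVecs (p ∷ a) = ∈-cartesianProductWith⁺ _∷_ (∈-bits p) (∈-allVecs a)
  where
  ∈-bits : ∀ p → p ∈ˡ 0ℙ ∷ 1ℙ ∷ []
  ∈-bits 0ℙ = here refl
  ∈-bits 1ℙ = there (here refl)

-- Induction on a list containing the support: a coordinate b with value 1 is cleared by adding
-- `e b`, which is added back afterwards.
units-generate : ∀ {r} {V : Code (Vec F r)} → Subspace V → (∀ a → V (e a)) → ∀ x → V x
units-generate {r} {V} S units x = supported (allVecs r) x (λ a _ → ∈-allVecs a)
  where
  supported : ∀ L x → (∀ a → x a ≡ 1ℙ → a ∈ˡ L) → V x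
  supported [] x sup = resp S (λ a → vanish a) (𝟘∈ S)
    where
    vanish : ∀ a → 0ℙ ≡ x a
    vanish a with x a in eq
    ... | 0ℙ = refl
    ... | 1ℙ with () ← sup a eq
  supported (b ∷ L) x sup with x b in x-b
  ... | 0ℙ = supported L x sup′
    where
    sup′ : ∀ a → x a ≡ 1ℙ → a ∈ˡ L
    sup′ a x-a with sup a x-a
    ... | here refl with () ← trans (sym x-b) x-a
    ... | there a∈L = a∈L
  ... | 1ℙ = resp S (λ a → +-cancel (x a) (e b a))
    (⊹-closed S (supported L (x ⊹ e b) sup′) (units b))
    where
    sup′ : ∀ a → x a ℙ.+ e b a ≡ 1ℙ → a ∈ˡ L
    sup′ a x-a with ≡-dec _≟_ b a
    ... | yes refl with () ← trans (sym x-a) (cong (ℙ._+ 1ℙ) x-b)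
    ... | no b≢a with sup a (trans (sym (ℙ.+-identityʳ (x a))) x-a)
    ...   | here a≡b  = contradiction (sym a≡b) b≢a
    ...   | there a∈L = a∈L

scale : ∀ {I} → F → Word I → Word I
scale α x i = α ℙ.* x i

-- The words x with x + total(x) e_0 in V form a subspace. It contains every e_a, whose total is 1,
-- and hence every word; for even x the correction vanishes.
even-generate : ∀ {r} {V : Code (Vec F r)} → Subspace V →
                (∀ a → V (e a ⊹ e 𝟎)) → Even r ⊆ V
even-generate {r} {V} S gens {x} t =
  resp S (λ i → trans (cong (λ p → x i ℙ.+ (p ℙ.* e 𝟎 i)) t) (ℙ.+-identityʳ (x i)))
    (units-generate corrected units x)
  where
  V′ : Code (Vec F r)
  V′ x = V (x ⊹ scale (total x) (e 𝟎))

  units : ∀ a → V′ (e a)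
  units a = resp S (λ i → cong (λ p → e a i ℙ.+ (p ℙ.* e 𝟎 i)) (sym (total-e a))) (gens a)

  corrected : Subspace V′
  corrected = record
    { resp     = λ x≗y → resp S λ i →
        cong₂ (λ q p → q ℙ.+ (p ℙ.* e 𝟎 i)) (x≗y i) (total-cong x≗y)
    ; 𝟘∈       = resp S (λ i → cong (ℙ._* e 𝟎 i) (sym (total-𝟘 {r}))) (𝟘∈ S)
    ; ⊹-closed = λ {x} {y} Vx Vy → resp S (λ i → trans
        (+-interchange (x i) (total x ℙ.* e 𝟎 i) (y i) (total y ℙ.* e 𝟎 i))
        (cong (x i ℙ.+ y i ℙ.+_)
          (sym (trans (cong (ℙ._* e 𝟎 i) (total-homo x y))
                      (ℙ.*-distribʳ-+ (e 𝟎 i) (total x) (total y))))))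
        (⊹-closed S Vx Vy)
    }

-- The span of S

permute-linear : ∀ {I} (τ : I ↔ I) → Linear (permute τ)
permute-linear τ = record { respects = λ e b → e (Inverse.from τ b) ; homo = λ _ _ _ → refl }

permute-injective : ∀ {I} (τ : I ↔ I) {x} → permute τ x ≗ 𝟘 → x ≗ 𝟘
permute-injective τ {x} z a =
  trans (cong x (sym (Inverse.strictlyInverseʳ τ a))) (z (Inverse.to τ a))

permute-e : ∀ {r} (τ : Vec F r ↔ Vec F r) a → permute τ (e a) ≗ e (Inverse.to τ a)
permute-e τ a b = e-transport
  (λ eq → trans (cong to eq) (strictlyInverseˡ b))
  (λ eq → trans (sym (strictlyInverseʳ a)) (cong from eq))
  where open Inverse τ

module _ {r} (τ : Vec F r ↔ Vec F r) where
  private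
    I = Vec F r
    τᴴ = image τ (ℋ r)
    τ⟨_⟩ = permute τ

  graph right : Word I → Word (I ⊎ I)
  graph x = [ x , τ⟨ x ⟩ ]
  right y = [ 𝟘 , y ]

  graph-linear : Linear graph
  graph-linear = record
    { respects = λ { e (inj₁ a) → e a ; e (inj₂ b) → e (Inverse.from τ b) }
    ; homo     = λ { _ _ (inj₁ _) → refl ; _ _ (inj₂ _) → refl } }

  right-linear : Linear right
  right-linear = record
    { respects = λ { e (inj₁ _) → refl ; e (inj₂ b) → e b }
    ; homo     = λ { _ _ (inj₁ _) → refl ; _ _ (inj₂ _) → refl } }

  graph-right-direct : ∀ C D → Direct graph right C D
  graph-right-direct _ _ _ _ eq = eq ∘ inj₁ ,
    λ b → trans (sym (eq (inj₂ b))) (eq (inj₁ (Inverse.from τ b)))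

  GraphSum : Code (I ⊎ I)
  GraphSum = Sum graph right (Even r) (Sum id id (ℋ r) τᴴ)

  GraphSum-Dim : ∀ {k n} → Dim (Even r) k → Dim (Sum id id (ℋ r) τᴴ) n →
                 Dim GraphSum (k + n)
  GraphSum-Dim = Sum-Dim graph-linear right-linear
    (graph-right-direct (Even r) (Sum id id (ℋ r) τᴴ))

  -- One inclusion holds because `GraphSum` is a subspace containing `S τ`. For the other, the coset
  -- a = 0 yields (h | h′) with both halves in ℋ, and the words e_a + e_0 yield (x | τ(x)) for all
  -- even x. The `Dim` arguments also supply the subspace properties.
  Span-S : ∀ {m n} → Inverse.to τ 𝟎 ≡ 𝟎 → Dim (ℋ r) m → Dim (Sum id id (ℋ r) τᴴ) n →
           GraphSum ≐ Span (S τ)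
  Span-S τ𝟎 dℋ dT = ⊆′ , Span-least (Dim⇒Subspace dV) S⊆GraphSum
    where
    dV = GraphSum-Dim (proj₂ (proj₂ (Even-Dim r))) dT
    Sℋ = Dim⇒Subspace dℋ
    SS = Span-subspace {C = S τ}

    ℋ⇒Even : ℋ r ⊆ Even r
    ℋ⇒Even = proj₂ ∘ proj₂ Check≐ℋ

    even-gen : ∀ a → total (e a ⊹ e {r} 𝟎) ≡ 0ℙ
    even-gen a = trans (total-homo (e a) (e 𝟎)) (cong₂ ℙ._+_ (total-e a) (total-e {r} 𝟎))

    τ-gen : ∀ a → τ⟨ e a ⊹ e 𝟎 ⟩ ≗ e (Inverse.to τ a) ⊹ e 𝟎
    τ-gen a b = cong₂ ℙ._+_ (permute-e τ a b)
      (trans (permute-e τ 𝟎 b) (cong (λ z → e z b) τ𝟎))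

    S⊆GraphSum : S τ ⊆ GraphSum
    S⊆GraphSum {w} (a , x , y , (h , ℋh , x≗) , (h′ , ℋh′ , y≗) , w≗) =
      -- Applying τ to the left half gives τ(h) + e_τ(a) + e_0, which differs from the right half by
      -- h′ + τ(h).
      h ⊹ (e a ⊹ e 𝟎) , h′ ⊹ τ⟨ h ⟩
      , trans (total-homo h (e a ⊹ e 𝟎)) (cong₂ ℙ._+_ (ℋ⇒Even ℋh) (even-gen a))
      , (h′ , τ⟨ h ⟩ , ℋh′ , (h , ℋh , λ _ → refl) , λ _ → refl)
      , λ { (inj₁ i) → trans (w≗ (inj₁ i)) (trans (x≗ i) (sym (ℙ.+-identityʳ _)))
          ; (inj₂ j) → trans (w≗ (inj₂ j)) (trans (y≗ j)
              (sym (trans (cong (λ t → τ⟨ h ⟩ j ℙ.+ t ℙ.+ (h′ j ℙ.+ τ⟨ h ⟩ j)) (τ-gen a j))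
                     (regroup (τ⟨ h ⟩ j) (h′ j) _)))) }
      where
      regroup : ∀ t h s → t ℙ.+ s ℙ.+ (h ℙ.+ t) ≡ h ℙ.+ s
      regroup = from-yes (∀? λ t → ∀? λ h → ∀? λ s → t ℙ.+ s ℙ.+ (h ℙ.+ t) ≟ h ℙ.+ s)

    ℋ×ℋ : ∀ {x y} → ℋ r x → ℋ r y → Span (S τ) [ x , y ]
    -- At a = 0 both cosets are ℋ itself, since τ fixes 0 and e_0 + e_0 = 0.
    ℋ×ℋ {x} {y} ℋx ℋy = Span-⊇ {C = S τ}
      ( 𝟎 , x , y
      , (x , ℋx , λ i → sym (trans (cong (x i ℙ.+_) (ℙ.p+p≡0ℙ (e 𝟎 i))) (ℙ.+-identityʳ (x i))))
      , (y , ℋy , λ i → sym (trans (cong (λ z → y i ℙ.+ (e z i ℙ.+ e 𝟎 i)) τ𝟎)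
          (trans (cong (y i ℙ.+_) (ℙ.p+p≡0ℙ (e 𝟎 i))) (ℙ.+-identityʳ (y i)))))
      , λ _ → refl )

    graph-subspace : Subspace (λ x → Span (S τ) (graph x))
    graph-subspace = record
      { resp     = λ x≗y → resp SS (respects graph-linear x≗y)
      ; 𝟘∈       = resp SS (λ i → sym (𝟘-homo graph-linear i)) (𝟘∈ SS)
      ; ⊹-closed = λ {x} {y} Gx Gy →
          resp SS (λ i → sym (homo graph-linear x y i)) (⊹-closed SS Gx Gy) }

    graph-gen : ∀ a → Span (S τ) (graph (e a ⊹ e 𝟎))
    graph-gen a = Span-⊇ {C = S τ}
      ( a , e a ⊹ e 𝟎 , τ⟨ e a ⊹ e 𝟎 ⟩
      , (𝟘 , 𝟘∈ Sℋ , λ _ → refl) , (𝟘 , 𝟘∈ Sℋ , τ-gen a) , λ _ → refl )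

    graph∈ : ∀ {x} → Even r x → Span (S τ) (graph x)
    graph∈ = even-generate graph-subspace graph-gen

    right-τ : ∀ h → graph h ⊹ [ h , 𝟘 ] ≗ right τ⟨ h ⟩
    right-τ h (inj₁ i) = ℙ.p+p≡0ℙ (h i)
    right-τ h (inj₂ j) = ℙ.+-identityʳ (τ⟨ h ⟩ j)

    ⊆′ : GraphSum ⊆ Span (S τ)
    ⊆′ (x , y , t , (h , z , ℋh , (h′ , ℋh′ , z≗) , y≗) , w≗) =
      -- The word is (x | τ(x)) + (0 | h) + (0 | τ(h′)), and the last term is (h′ | τ(h′)) + (h′ |
      -- 0).
      resp SS (λ i → sym (w≗ i)) (⊹-closed SS (graph∈ t)
        (resp SS (λ i → trans (sym (homo right-linear h z i)) (sym (respects right-linear y≗ i)))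
          (⊹-closed SS (ℋ×ℋ (𝟘∈ Sℋ) ℋh)
            (resp SS (λ i → trans (right-τ h′ i) (sym (respects right-linear z≗ i)))
              (⊹-closed SS (graph∈ (ℋ⇒Even ℋh′)) (ℋ×ℋ ℋh′ (𝟘∈ Sℋ)))))))

-- Dimension count

rank-arithmetic : ∀ r {N k m d c} → suc k ≡ N → m + suc r ≡ N → d + c ≡ m →
                  k + (m + c) ≡ (N + N ∸ r ∸ 2) + (N ∸ r ∸ 1 ∸ d)
rank-arithmetic r {N} {k} {m} {d} {c} suc-k≡N m+suc-r≡N d+c≡m =
  trans (sym (+-assoc k m c)) (sym (cong₂ _+_ first second))
  where
  open ≡-Reasoning
  open +-*-Solver
  -- The two equations for N add up to k + m + (r + 2) = N + N, so the subtraction is exact.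
  first : N + N ∸ r ∸ 2 ≡ k + m
  first = begin
    N + N ∸ r ∸ 2                 ≡⟨ ∸-+-assoc (N + N) r 2 ⟩
    N + N ∸ (r + 2)               ≡⟨ cong (_∸ (r + 2)) (sym (cong₂ _+_ suc-k≡N m+suc-r≡N)) ⟩
    suc k + (m + suc r) ∸ (r + 2) ≡⟨ cong (_∸ (r + 2)) (solve 3 (λ k m r →
      con 1 :+ k :+ (m :+ (con 1 :+ r)) := k :+ m :+ (r :+ con 2)) refl k m r) ⟩
    k + m + (r + 2) ∸ (r + 2)     ≡⟨ m+n∸n≡m (k + m) (r + 2) ⟩
    k + m                         ∎

  -- As N - r - 1 = m, the distension m - d is c.
  second : N ∸ r ∸ 1 ∸ d ≡ c
  second = begin
    N ∸ r ∸ 1 ∸ d               ≡⟨ cong (_∸ d) (∸-+-assoc N r 1) ⟩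
    N ∸ (r + 1) ∸ d             ≡⟨ cong (λ n → N ∸ n ∸ d) (+-comm r 1) ⟩
    N ∸ suc r ∸ d               ≡⟨ cong (λ n → n ∸ suc r ∸ d) (sym m+suc-r≡N) ⟩
    m + suc r ∸ suc r ∸ d       ≡⟨ cong (_∸ d) (m+n∸n≡m m (suc r)) ⟩
    m ∸ d                       ≡⟨ cong (_∸ d) (sym d+c≡m) ⟩
    d + c ∸ d                   ≡⟨ m+n∸m≡n d c ⟩
    c                           ∎

lemma1 : ∀ (r : ℕ) → 1 ≤ r →
    (τ : Vec F r ↔ Vec F r) → Inverse.to τ 𝟎 ≡ 𝟎 →
    (l : ℕ) → IsDistension τ l →
    HasRank (S τ) ((2 ^ (r + 1) ∸ r ∸ 2) + l)
lemma1 r _ τ τ𝟎 l (d , dim∩ , refl)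
  with k , suc-k≡ , dE ← Even-Dim r | m , m+suc-r≡ , dC ← Check-Dim r
  with dℋ ← Dim-resp Check≐ℋ dC
  -- Permuting coordinates is injective, so τ(ℋ) also has dimension m, and c counts the dimensions
  -- that it adds to ℋ.
  with c , d+c≡m , dT ← Sum-∩-Dim dℋ
         (image-Dim (permute-linear τ) (permute-injective τ) dℋ)
         (HasDimension⇒Dim dim∩) =
  Dim⇒HasDimension
    (subst (Dim (Span (S τ)))
      (trans (rank-arithmetic r suc-k≡ m+suc-r≡ d+c≡m)
        (cong (λ n → (n ∸ r ∸ 2) + (2 ^ r ∸ r ∸ 1 ∸ d)) 2^r+2^r))
      (Dim-resp (Span-S τ τ𝟎 dℋ dT)
        (GraphSum-Dim τ dE dT)))
  where
  2^r+2^r : 2 ^ r + 2 ^ r ≡ 2 ^ (r + 1)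
  2^r+2^r = trans (double (2 ^ r)) (cong (2 ^_) (+-comm 1 r))
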